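{- Let $G$ be any graph and let $H\in\mathcal{H}$ be a graph with $\chi(H)=\chi_i(H)=\ell$. Then $G[H]$ is $k$-indicated colorable if and only if $G[K_\ell]$ is $k$-indicated colorable. In particular, $\chi_i(G[H])=\chi_i(G[K_\ell])$.
   Context: All graphs are finite, simple and undirected. Indicated coloring game on a graph $G$ with a fixed set of $k$ colors: in each round Ann selects an uncolored vertex and Ben assigns it a color from the set so that the partial coloring stays proper. Ann wins if all vertices get colored; Ben wins if some uncolored vertex has neighbors carrying all $k$ colors (a block vertex). $G$ is $k$-indicated colorable if Ann has a winning strategy with $k$ colors regardless of Ben's play; the indicated chromatic number $\chi_i(G)$ is the least such $k$. $\chi(G)$ is the chromatic number, $K_\ell$ the complete graph on $\ell$ vertices. The lexicographic product $G[H]$ has vertex set $V(G)\times V(H)$, with $(x_1,y_1)\sim(x_2,y_2)$ iff either $x_1=x_2$ and $y_1y_2\in E(H)$, or $x_1x_2\in E(G)$. The family $\mathcal{H}$: a graph $G$ belongs to $\mathcal{H}$ if Ann has a winning strategy using $\chi_i(G)$ colors which she can follow until Ben has used $\chi_i(G)$ colors on the vertices of $G$, and for the remaining vertices she has a way of extending this to a winning strategy using $k$ colors, for any $k\geq\chi_i(G)$. -}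

module Defs where

open import Data.Nat using (ℕ; _≤_; _<_; _*_)
open import Data.Nat.Properties using () renaming (_≟_ to _≟ℕ_)
open import Data.Fin using (Fin; remQuot; _≟_)
open import Data.Bool using (Bool; true; false; _∧_; _∨_; not; if_then_else_)
open import Data.Bool.Properties using (∨-comm)
open import Data.Maybe using (Maybe; just; nothing)
import Data.Maybe as Maybe
open import Data.Product using (Σ; Σ-syntax; _×_; _,_; proj₁; proj₂; map₂)
open import Data.List using (List; []; _∷_; length; deduplicate)
import Data.List as List
open import Relation.Nullary using (¬_; Dec; yes; no)
open import Relation.Nullary.Decidable using (⌊_⌋)
open import Relation.Binary.PropositionalEquality using (_≡_; _≢_; refl; sym; cong₂)
open import Function.Definitions using (Injective)

record Graph : Set where
  field
    n      : ℕ
    adj    : Fin n → Fin n → Bool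
    adj-sym    : ∀ u v → adj u v ≡ adj v u
    adj-irrefl : ∀ v → adj v v ≡ false
open Graph public

private
  ⌊≟⌋-sym : ∀ {m} (x y : Fin m) → ⌊ x ≟ y ⌋ ≡ ⌊ y ≟ x ⌋
  ⌊≟⌋-sym x y with x ≟ y | y ≟ x
  ... | yes _  | yes _ = refl
  ... | yes p  | no ¬q = Relation.Nullary.contradiction (sym p) ¬q
    where import Relation.Nullary
  ... | no ¬p  | yes q = Relation.Nullary.contradiction (sym q) ¬p
    where import Relation.Nullary
  ... | no _   | no _  = refl

  ⌊≟⌋-refl : ∀ {m} (x : Fin m) → ⌊ x ≟ x ⌋ ≡ true
  ⌊≟⌋-refl x with x ≟ x
  ... | yes _ = refl
  ... | no ¬p = Relation.Nullary.contradiction refl ¬p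
    where import Relation.Nullary

K : ℕ → Graph
K ℓ = record
  { n = ℓ
  ; adj = λ u v → not ⌊ u ≟ v ⌋
  ; adj-sym = λ u v → Relation.Binary.PropositionalEquality.cong not (⌊≟⌋-sym u v)
  ; adj-irrefl = λ v → Relation.Binary.PropositionalEquality.cong not (⌊≟⌋-refl v)
  }

lexAdj : (G H : Graph) → Fin (n G) × Fin (n H) → Fin (n G) × Fin (n H) → Bool
lexAdj G H (x₁ , y₁) (x₂ , y₂) = (⌊ x₁ ≟ x₂ ⌋ ∧ adj H y₁ y₂) ∨ adj G x₁ x₂

private
  lexAdj-sym : ∀ G H p q → lexAdj G H p q ≡ lexAdj G H q p
  lexAdj-sym G H (x₁ , y₁) (x₂ , y₂) =
    cong₂ _∨_ (cong₂ _∧_ (⌊≟⌋-sym x₁ x₂) (Graph.adj-sym H y₁ y₂)) (Graph.adj-sym G x₁ x₂)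

  lexAdj-irr : ∀ G H p → lexAdj G H p p ≡ false
  lexAdj-irr G H (x , y)
    rewrite ⌊≟⌋-refl x | Graph.adj-irrefl H y | Graph.adj-irrefl G x = refl

lex : Graph → Graph → Graph
lex G H = record
  { n = n G * n H
  ; adj = λ u v → lexAdj G H (remQuot (n H) u) (remQuot (n H) v)
  ; adj-sym = λ u v → lexAdj-sym G H (remQuot (n H) u) (remQuot (n H) v)
  ; adj-irrefl = λ v → lexAdj-irr G H (remQuot (n H) v)
  }

ProperColoring : (G : Graph) (k : ℕ) → (Fin (n G) → Fin k) → Set
ProperColoring G k f = ∀ u v → adj G u v ≡ true → f u ≢ f v

Colorable : Graph → ℕ → Set
Colorable G k = Σ[ f ∈ (Fin (n G) → Fin k) ] ProperColoring G k f

IsChromaticNumber : Graph → ℕ → Set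
IsChromaticNumber G ℓ = Colorable G ℓ × (∀ j → j < ℓ → ¬ Colorable G j)

-- The indicated coloring game.
-- Colours are natural numbers; in the game with k colours only colours a < k
-- are used.  A position is a partial colouring (nothing = uncoloured).

Pos : ℕ → Set
Pos m = Fin m → Maybe ℕ

Avail : (G : Graph) → Pos (n G) → Fin (n G) → ℕ → Set
Avail G c v a = ∀ u → adj G u v ≡ true → c u ≢ just a

AllColored : ∀ {m} → Pos m → Set
AllColored c = ∀ v → c v ≢ nothing

update : ∀ {m} → Pos m → Fin m → ℕ → Pos m
update c v a u = if ⌊ u ≟ v ⌋ then just a else c u

-- Win G k c : Ann has a winning strategy with k colours from position c.
-- Either all vertices are coloured (Ann won), or Ann picks an uncoloured
-- vertex v which is not a block vertex (Ben can colour it) and for every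
-- legal colour a Ben may choose, Ann wins from the resulting position.
-- (A block vertex can never be coloured later, so a position containing one
-- is never winning.)
data Win (G : Graph) (k : ℕ) (c : Pos (n G)) : Set where
  done : AllColored c → Win G k c
  move : (v : Fin (n G)) → c v ≡ nothing
       → (Σ[ a ∈ ℕ ] (a < k × Avail G c v a))
       → (∀ a → a < k → Avail G c v a → Win G k (update c v a))
       → Win G k c

IndColorable : Graph → ℕ → Set
IndColorable G k = Win G k (λ _ → nothing)

IsIndChromaticNumber : Graph → ℕ → Set
IsIndChromaticNumber G ℓ = IndColorable G ℓ × (∀ j → j < ℓ → ¬ IndColorable G j)

-- Strategies for Ann (history dependent) and the family ℋ.
-- A history is the list of moves (vertex, colour), most recent first.

Hist : ℕ → Set
Hist m = List (Fin m × ℕ)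

posOf : ∀ {m} → Hist m → Pos m
posOf []            v = nothing
posOf ((u , a) ∷ h) v = if ⌊ u ≟ v ⌋ then just a else posOf h v

nUsed : ∀ {m} → Hist m → ℕ
nUsed h = length (deduplicate _≟ℕ_ (List.map proj₂ h))

Strategy : ℕ → Set
Strategy m = Hist m → Fin m

-- a strategy is a strategy "of the game" only if it does not depend on the
-- names of the colours (so the same strategy can be followed for any number
-- of colours)
ColourInvariant : ∀ {m} → Strategy m → Set
ColourInvariant σ =
  ∀ (f : ℕ → ℕ) → Injective _≡_ _≡_ f → ∀ h → σ (List.map (map₂ f) h) ≡ σ h

data FollowWin (G : Graph) (σ : Strategy (n G)) (k : ℕ) (h : Hist (n G)) : Set where
  done : AllColored (posOf h) → FollowWin G σ k h
  move : posOf h (σ h) ≡ nothing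
       → (Σ[ a ∈ ℕ ] (a < k × Avail G (posOf h) (σ h) a))
       → (∀ a → a < k → Avail G (posOf h) (σ h) a → FollowWin G σ k ((σ h , a) ∷ h))
       → FollowWin G σ k h

data FollowThenWin (G : Graph) (σ : Strategy (n G)) (ℓ k : ℕ) (h : Hist (n G)) : Set where
  switch : ℓ ≤ nUsed h → Win G k (posOf h) → FollowThenWin G σ ℓ k h
  done   : AllColored (posOf h) → FollowThenWin G σ ℓ k h
  move   : nUsed h < ℓ
         → posOf h (σ h) ≡ nothing
         → (Σ[ a ∈ ℕ ] (a < k × Avail G (posOf h) (σ h) a))
         → (∀ a → a < k → Avail G (posOf h) (σ h) a → FollowThenWin G σ ℓ k ((σ h , a) ∷ h))
         → FollowThenWin G σ ℓ k h

InFamilyH : Graph → Set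
InFamilyH G =
  Σ[ ℓ ∈ ℕ ] (IsIndChromaticNumber G ℓ ×
  Σ[ σ ∈ Strategy (n G) ] (ColourInvariant σ ×
     FollowWin G σ ℓ [] ×
     (∀ k → ℓ ≤ k → FollowThenWin G σ ℓ k [])))

{-# OPTIONS --safe #-}
module Submission where

-- G[H] ⇒ G[K_ℓ]. Fix a proper ℓ-colouring φ of H and let the answer to (x , v) in the imagined game on G[H]
-- be the colour of (x , φ v), which Ann presents if it is still uncoloured.
-- G[K_ℓ] ⇒ G[H]. When (x , i) is to be presented, Ann follows σ in the copy of H at x until Ben uses a colour
-- that is new to that copy, and takes it as the answer for (x , i); a copy with fewer than ℓ colours is not full
-- because χ(H) = ℓ.  When G[K_ℓ] is full, every copy of H carries at least ℓ colours, so each can be completed in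
-- turn by the second phase of σ, played with the colours that are absent from the neighbouring copies.
-- Renaming these to 0, …, j - 1 does not affect the first phase because σ is colour invariant.

open import Defs
open import Data.Nat using (ℕ; _≤_; _<_; _+_)
open import Data.Nat.Properties
  using (≤-trans; ≤-antisym; ≤-reflexive; ≤-<-trans; <-≤-trans; <⇒≱; ≰⇒>; _≤?_; <-cmp; m≤m+n; +-cancelˡ-≡)
  renaming (_≟_ to _≟ℕ_)
open import Data.Fin using (Fin; toℕ; fromℕ<; combine; _≟_; zero; suc)
open import Data.Fin.Properties
  using (any?; injective⇒≤; remQuot-combine; combine-remQuot; combine-injective; toℕ<n; toℕ-injective; toℕ-fromℕ<)
open import Data.Bool using (true; false; _∨_)
open import Data.Bool.Properties using (∨-zeroʳ) renaming (_≟_ to _≟ᵇ_)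
open import Data.Maybe using (Maybe; just; nothing; fromMaybe)
import Data.Maybe as Maybe
open import Data.Maybe.Properties using (just-injective; map-injective) renaming (≡-dec to Maybe-≡-dec)
open import Data.Product using (∃-syntax; _×_; _,_; proj₁; proj₂; map₂)
open import Data.Sum using (_⊎_; inj₁; inj₂)
open import Data.List using (List; []; _∷_; length; map; filter; lookup; allFin; upTo; deduplicate)
open import Data.List.Properties using (length-map; length-tabulate; length-upTo; filter-notAll; map-id)
open import Data.List.Membership.Propositional using (_∈_; _∉_; lose)
open import Data.List.Membership.Propositional.Properties
  using (∈-map⁺; ∈-map⁻; ∈-filter⁺; ∈-filter⁻; ∈-allFin; ∈-upTo⁺; ∈-upTo⁻; ∈-lookup; ∈-deduplicate⁺; ∈-deduplicate⁻)
open import Data.List.Membership.DecPropositional _≟ℕ_ using (_∈?_)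
open import Data.List.Relation.Unary.Any using (here; there; index)
open import Data.List.Relation.Unary.Any.Properties using (lookup-index)
open import Data.List.Relation.Unary.All as All using (All; []; _∷_)
open import Data.List.Relation.Unary.AllPairs using ([]; _∷_)
open import Data.List.Relation.Unary.Unique.Propositional using (Unique)
open import Data.List.Relation.Unary.Unique.Propositional.Properties using (map⁺; filter⁺; upTo⁺)
open import Data.List.Relation.Unary.Unique.DecPropositional.Properties _≟ℕ_ using (deduplicate-!)
open import Relation.Nullary using (¬_; Dec; yes; no; contradiction)
open import Relation.Nullary.Decidable using (¬?; decidable-stable; _×-dec_)
open import Relation.Binary.Definitions using (tri<; tri≈; tri>)
open import Relation.Binary.PropositionalEquality using (_≡_; _≢_; refl; sym; trans; cong; cong₂; subst)
open import Function using (_∘_; id)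
open import Function.Definitions using (Injective)
open import Function.Bundles using (_⇔_; mk⇔)

-- Lists without repetitions and counting of colours.

lookup-injective : ∀ {A : Set} {xs : List A} → Unique xs → ∀ i j → lookup xs i ≡ lookup xs j → i ≡ j
lookup-injective (_ ∷ _)   zero    zero    _  = refl
lookup-injective (x∉ ∷ _)  zero    (suc j) eq = contradiction eq (All.lookup x∉ (∈-lookup j))
lookup-injective (x∉ ∷ _)  (suc i) zero    eq = contradiction (sym eq) (All.lookup x∉ (∈-lookup i))
lookup-injective (_ ∷ xs!) (suc i) (suc j) eq = cong suc (lookup-injective xs! i j eq)

index-injective : ∀ {A : Set} {xs : List A} {x y} (p : x ∈ xs) (q : y ∈ xs) → index p ≡ index q → x ≡ y
index-injective {xs = xs} p q eq =
  trans (lookup-index p) (trans (cong (lookup xs) eq) (sym (lookup-index q)))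

-- Sending a position of `xs` to a position of the same element in `ys` is injective.
unique-⊆⇒length≤ : ∀ {A : Set} {xs ys : List A} → Unique xs → (∀ {a} → a ∈ xs → a ∈ ys) → length xs ≤ length ys
unique-⊆⇒length≤ {xs = xs} xs! sub = injective⇒≤ {f = λ i → index (sub (∈-lookup {xs = xs} i))}
  (λ {i} {j} eq → lookup-injective xs! i j (index-injective (sub (∈-lookup i)) (sub (∈-lookup j)) eq))

others : ∀ {m} → Fin m → List (Fin m)
others {m} i = filter (λ j → ¬? (j ≟ i)) (allFin m)

length-others : ∀ {m} (i : Fin m) → length (others i) < m
length-others {m} i = <-≤-trans
  (filter-notAll (λ j → ¬? (j ≟ i)) (allFin m) (lose (∈-allFin i) (λ i≢i → i≢i refl)))
  (≤-reflexive (length-tabulate {n = m} id))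

∈-others : ∀ {m} {i j : Fin m} → j ≢ i → j ∈ others i
∈-others {i = i} {j} j≢i = ∈-filter⁺ (λ j → ¬? (j ≟ i)) (∈-allFin j) j≢i

-- Uncoloured vertices contribute the default 0. A spurious 0 is harmless: the list serves only as
-- an upper bound of length below `m` that contains the colours of all `j ≢ i`.
coloursExcept : ∀ {m} → Pos m → Fin m → List ℕ
coloursExcept e i = map (λ j → fromMaybe 0 (e j)) (others i)

length-coloursExcept : ∀ {m} (e : Pos m) i → length (coloursExcept e i) < m
length-coloursExcept {m} e i = subst (_< m) (sym (length-map _ (others i))) (length-others i)

∈-coloursExcept : ∀ {m} (e : Pos m) {i j a} → j ≢ i → e j ≡ just a → a ∈ coloursExcept e i
∈-coloursExcept e {i} j≢i ej =
  subst (_∈ coloursExcept e i) (cong (fromMaybe 0) ej) (∈-map⁺ _ (∈-others j≢i))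

-- Injective on all of ℕ, and a bijection from the members of C onto {a | a < length C} when C has no repetitions.
rank : List ℕ → ℕ → ℕ
rank C a with a ∈? C
... | yes p = toℕ (index p)
... | no _  = length C + a

rank-injective : ∀ C → Injective _≡_ _≡_ (rank C)
rank-injective C {a} {b} eq with a ∈? C | b ∈? C
... | yes p | yes q = index-injective p q (toℕ-injective eq)
... | yes p | no _  = contradiction (subst (length C ≤_) (sym eq) (m≤m+n (length C) b)) (<⇒≱ (toℕ<n (index p)))
... | no _  | yes q = contradiction (subst (length C ≤_) eq (m≤m+n (length C) a)) (<⇒≱ (toℕ<n (index q)))
... | no _  | no _  = +-cancelˡ-≡ (length C) a b eq

rank< : ∀ {C a} → a ∈ C → rank C a < length C
rank< {C} {a} a∈C with a ∈? C
... | yes p  = toℕ<n (index p)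
... | no a∉C = contradiction a∈C a∉C

rank-surjective : ∀ {C} → Unique C → ∀ {b} → b < length C → ∃[ a ] (a ∈ C × rank C a ≡ b)
rank-surjective {C} C! {b} b< = lookup C i , ∈-lookup i , eq
  where
  i = fromℕ< b<
  eq : rank C (lookup C i) ≡ b
  eq with lookup C i ∈? C
  -- The membership test might find a position other than `i`; absence of repetitions makes the two
  -- equal.
  ... | yes p = trans (cong toℕ (lookup-injective C! (index p) i (sym (lookup-index p)))) (toℕ-fromℕ< b<)
  ... | no ∉C = contradiction (∈-lookup i) ∉C

-- Partial colourings and positions of the game.

coloured : ∀ (x : Maybe ℕ) → x ≢ nothing → ∃[ a ] x ≡ just a
coloured (just a) _  = a , refl
coloured nothing  x≢ = contradiction refl x≢

just≢nothing : ∀ {x : Maybe ℕ} {a} → x ≡ just a → x ≢ nothing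
just≢nothing refl ()

update-same : ∀ {m} (c : Pos m) v a → update c v a v ≡ just a
update-same c v a with v ≟ v
... | yes _  = refl
... | no v≢v = contradiction refl v≢v

update-other : ∀ {m} (c : Pos m) {v u} a → u ≢ v → update c v a u ≡ c u
update-other c {v} {u} a u≢v with u ≟ v
... | yes u≡v = contradiction u≡v u≢v
... | no _    = refl

update-just⁻ : ∀ {m} (c : Pos m) v a {u b} → update c v a u ≡ just b → (u ≡ v × a ≡ b) ⊎ c u ≡ just b
update-just⁻ c v a {u} eq with u ≟ v
... | yes u≡v = inj₁ (u≡v , just-injective eq)
... | no _    = inj₂ eq

update-just⁺ : ∀ {m} (c : Pos m) {v u b} a → c v ≡ nothing → c u ≡ just b → update c v a u ≡ just b
update-just⁺ c a cv cu = trans (update-other c a (λ { refl → just≢nothing cu cv })) cu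

Proper : (G : Graph) → Pos (n G) → Set
Proper G c = ∀ u v a → adj G u v ≡ true → c u ≡ just a → c v ≢ just a

Bounded : ∀ {m} → ℕ → Pos m → Set
Bounded k c = ∀ u a → c u ≡ just a → a < k

Extends : ∀ {m} → Pos m → Pos m → Set
Extends c c′ = ∀ u a → c u ≡ just a → c′ u ≡ just a

adj⇒≢ : ∀ G {u v} → adj G u v ≡ true → u ≢ v
adj⇒≢ G {u} uv refl with trans (sym uv) (adj-irrefl G u)
... | ()

proper-update : ∀ G c v a → Avail G c v a → Proper G c → Proper G (update c v a)
proper-update G c v a av pr u w b uw cu cw
  with update-just⁻ c v a cu | update-just⁻ c v a cw
... | inj₁ (refl , _)    | inj₁ (refl , _)    = adj⇒≢ G uw refl
... | inj₁ (refl , refl) | inj₂ cw′           = av w (trans (adj-sym G w u) uw) cw′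
... | inj₂ cu′           | inj₁ (refl , refl) = av u uw cu′
... | inj₂ cu′           | inj₂ cw′           = pr u w b uw cu′ cw′

bounded-update : ∀ {m k} (c : Pos m) v a → a < k → Bounded k c → Bounded k (update c v a)
bounded-update c v a a<k bd u b cu with update-just⁻ c v a cu
... | inj₁ (_ , refl) = a<k
... | inj₂ cu′        = bd u b cu′

-- One play suffices: Ben always answers with the colour that witnesses that the presented vertex is
-- not blocked.
win⇒colouring : ∀ G k c → Win G k c → Proper G c → Bounded k c →
  ∃[ c′ ] (AllColored c′ × Proper G c′ × Bounded k c′ × Extends c c′)
win⇒colouring G k c (done all) pr bd = c , all , pr , bd , λ _ _ eq → eq
win⇒colouring G k c (move v cv (a , a<k , av) next) pr bd
  with win⇒colouring G k (update c v a) (next a a<k av) (proper-update G c v a av pr) (bounded-update c v a a<k bd)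
... | c′ , all , pr′ , bd′ , ext = c′ , all , pr′ , bd′ , λ u b cu → ext u b (update-just⁺ c a cv cu)

avail? : ∀ G c v a → Dec (Avail G c v a)
avail? G c v a with any? (λ u → (adj G u v ≟ᵇ true) ×-dec (Maybe-≡-dec _≟ℕ_ (c u) (just a)))
... | yes (u , uv , cu) = no (λ av → av u uv cu)
... | no ¬bad           = yes (λ u uv cu → ¬bad (u , uv , cu))

NeedsColours : Graph → ℕ → Set
NeedsColours H ℓ = ∀ j → j < ℓ → ¬ Colorable H j

-- Replacing each colour by its position in `L` gives a proper colouring with `length L` colours.
-- This is the form in which the lower bound on the chromatic number is applied to positions, whose
-- colours are arbitrary naturals.
colours-needed : ∀ H {ℓ} → NeedsColours H ℓ → (e : Pos (n H)) → AllColored e → Proper H e →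
  (L : List ℕ) → (∀ v a → e v ≡ just a → a ∈ L) → ℓ ≤ length L
colours-needed H {ℓ} χ≥ e all pr L sub with ℓ ≤? length L
... | yes p = p
... | no ¬p = contradiction (colour , proper) (χ≥ (length L) (≰⇒> ¬p))
  where
  col : ∀ v → ∃[ a ] e v ≡ just a
  col v = coloured (e v) (all v)
  mem : ∀ v → proj₁ (col v) ∈ L
  mem v = sub v _ (proj₂ (col v))
  colour : Fin (n H) → Fin (length L)
  colour v = index (mem v)
  proper : ProperColoring H (length L) colour
  proper u v uv eq = pr u v _ uv (proj₂ (col u))
    (trans (proj₂ (col v)) (cong just (sym (index-injective (mem u) (mem v) eq))))

-- The lexicographic product

vertex : (G H : Graph) → Fin (n G) → Fin (n H) → Fin (n (lex G H))
vertex G H = combine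

copy : ∀ G H → Pos (n (lex G H)) → Fin (n G) → Pos (n H)
copy G H c x v = c (vertex G H x v)

vertex-injective : ∀ G H x v y w → vertex G H x v ≡ vertex G H y w → x ≡ y × v ≡ w
vertex-injective G H = combine-injective

vertex-surjective : ∀ G H u → ∃[ x ] ∃[ v ] vertex G H x v ≡ u
vertex-surjective G H u = _ , _ , combine-remQuot {n G} (n H) u

vertex-elim : ∀ G H (P : Fin (n (lex G H)) → Set) → (∀ x v → P (vertex G H x v)) → ∀ u → P u
vertex-elim G H P f u with vertex-surjective G H u
... | x , v , refl = f x v

adj-vertex : ∀ G H x v y w → adj (lex G H) (vertex G H x v) (vertex G H y w) ≡ lexAdj G H (x , v) (y , w)
adj-vertex G H x v y w = cong₂ (lexAdj G H) (remQuot-combine x v) (remQuot-combine y w)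

lex-adj⁻ : ∀ G H x v y w → adj (lex G H) (vertex G H x v) (vertex G H y w) ≡ true →
  (x ≡ y × adj H v w ≡ true) ⊎ adj G x y ≡ true
lex-adj⁻ G H x v y w e = split (trans (sym (adj-vertex G H x v y w)) e)
  where
  split : lexAdj G H (x , v) (y , w) ≡ true → (x ≡ y × adj H v w ≡ true) ⊎ adj G x y ≡ true
  split eq with x ≟ y
  ... | no _ = inj₂ eq
  ... | yes x≡y with adj H v w
  ...   | true  = inj₁ (x≡y , refl)
  ...   | false = inj₂ eq

lex-adj-inside : ∀ G H x {v w} → adj H v w ≡ true → adj (lex G H) (vertex G H x v) (vertex G H x w) ≡ true
lex-adj-inside G H x {v} {w} vw = trans (adj-vertex G H x v x w) join
  where
  join : lexAdj G H (x , v) (x , w) ≡ true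
  join with x ≟ x
  ... | no x≢x           = contradiction refl x≢x
  ... | yes _ rewrite vw = refl

lex-adj-across : ∀ G H {x y} v w → adj G x y ≡ true → adj (lex G H) (vertex G H x v) (vertex G H y w) ≡ true
lex-adj-across G H {x} {y} v w xy = trans (adj-vertex G H x v y w) (trans (cong (_ ∨_) xy) (∨-zeroʳ _))

K-adj⁺ : ∀ {ℓ} {i j : Fin ℓ} → i ≢ j → adj (K ℓ) i j ≡ true
K-adj⁺ {i = i} {j} i≢j with i ≟ j
... | yes i≡j = contradiction i≡j i≢j
... | no _    = refl

needs-K : ∀ ℓ → NeedsColours (K ℓ) ℓ
needs-K ℓ j j<ℓ (f , pr) = <⇒≱ j<ℓ (injective⇒≤ inj)
  where
  inj : Injective _≡_ _≡_ f
  inj {u} {v} eq = decidable-stable (u ≟ v) λ u≢v → pr u v (K-adj⁺ u≢v) eq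

proper-copy : ∀ G H c → Proper (lex G H) c → ∀ x → Proper H (copy G H c x)
proper-copy G H c pr x v w a vw = pr (vertex G H x v) (vertex G H x w) a (lex-adj-inside G H x vw)

-- From G[H] to G[K_ℓ]

module _ (G H : Graph) (ℓ k : ℕ) (χ≥ : NeedsColours H ℓ)
         (φ : Fin (n H) → Fin ℓ) (φ-proper : ProperColoring H ℓ φ) where

  private
    verH = vertex G H
    verK = vertex G (K ℓ)

  -- If `φ` missed `i`, it would colour H properly with the other colours, of which there are fewer
  -- than ℓ.
  φ-surjective : ∀ i → ∃[ v ] φ v ≡ i
  φ-surjective i with any? (λ v → φ v ≟ i)
  ... | yes hit = hit
  ... | no miss = contradiction
    (colours-needed H χ≥ (λ v → just (toℕ (φ v))) (λ _ ())
      (λ u v a uv eu ev → φ-proper u v uv (toℕ-injective (just-injective (trans eu (sym ev)))))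
      (coloursExcept (just ∘ toℕ) i)
      (λ { v _ refl → ∈-coloursExcept (just ∘ toℕ) (λ eq → miss (v , eq)) refl }))
    (<⇒≱ (length-coloursExcept (just ∘ toℕ) i))

  -- The invariant between the imagined position `c` and the real position `d`. For `source`, any
  -- vertex of the copy at `x` will do: it only has to carry conflicts along edges of G.
  record Projects (c : Pos (n (lex G H))) (d : Pos (n (lex G (K ℓ)))) : Set where
    field
      image   : ∀ x v a → c (verH x v) ≡ just a → d (verK x (φ v)) ≡ just a
      source  : ∀ x i a → d (verK x i) ≡ just a → ∃[ v ] c (verH x v) ≡ just a
      proper  : Proper (lex G (K ℓ)) d
      bounded : Bounded k d

  lex-adj-φ : ∀ x v y w → adj (lex G H) (verH x v) (verH y w) ≡ true →
    adj (lex G (K ℓ)) (verK x (φ v)) (verK y (φ w)) ≡ true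
  lex-adj-φ x v y w e with lex-adj⁻ G H x v y w e
  ... | inj₁ (refl , vw) = lex-adj-inside G (K ℓ) x (K-adj⁺ (φ-proper v w vw))
  ... | inj₂ xy          = lex-adj-across G (K ℓ) (φ v) (φ w) xy

  module _ {c d} (R : Projects c d) where
    open Projects R

    -- `φ` sends edges to edges and keeps colours, so a conflict at (x , v) becomes one at (x , φ
    -- v).
    image-avail : ∀ x v a → Avail (lex G (K ℓ)) d (verK x (φ v)) a → Avail (lex G H) c (verH x v) a
    image-avail x v a av = vertex-elim G H _ λ y w yw cy →
      av (verK y (φ w)) (lex-adj-φ y w x v yw) (image y w a cy)

    proper-source : Proper (lex G H) c
    proper-source = vertex-elim G H _ λ x v → vertex-elim G H _ λ y w a e cx cy →
      proper _ _ a (lex-adj-φ x v y w e) (image x v a cx) (image y w a cy)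

    bounded-source : Bounded k c
    bounded-source = vertex-elim G H _ λ x v a cx → bounded _ a (image x v a cx)

    -- If (x , i) were blocked, then every proper completion of c would colour the copy of H at x
    -- with the colours of the vertices (x , j), j ≠ i, only, and those are fewer than ℓ.
    not-blocked : Win (lex G H) k c → ∀ x i → ∃[ a ] (a < k × Avail (lex G (K ℓ)) d (verK x i) a)
    not-blocked win x i with any? (λ (b : Fin k) → avail? (lex G (K ℓ)) d (verK x i) (toℕ b))
    ... | yes (b , av) = toℕ b , toℕ<n b , av
    ... | no blocked with win⇒colouring (lex G H) k c win proper-source bounded-source
    ...   | c′ , all , pr , bd , ext = contradiction
      (colours-needed H χ≥ (copy G H c′ x) (λ v → all (verH x v)) (proper-copy G H c′ pr x) L c′⊆L)
      (<⇒≱ (length-coloursExcept (copy G (K ℓ) d x) i))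
      where
      L = coloursExcept (copy G (K ℓ) d x) i

      c′⊆L : ∀ v a → c′ (verH x v) ≡ just a → a ∈ L
      c′⊆L v a c′v = decidable-stable (a ∈? L) λ a∉L →
        blocked (fromℕ< a<k , subst (Avail (lex G (K ℓ)) d (verK x i)) (sym (toℕ-fromℕ< a<k))
          (vertex-elim G (K ℓ) _ λ y j yj dy → case y j (lex-adj⁻ G (K ℓ) y j x i yj) yj dy a∉L))
        where
        a<k = bd _ a c′v
        case : ∀ y j → (y ≡ x × adj (K ℓ) j i ≡ true) ⊎ adj G y x ≡ true →
          adj (lex G (K ℓ)) (verK y j) (verK x i) ≡ true →
          d (verK y j) ≡ just a → ¬ a ∉ L
        case y j (inj₁ (refl , ji)) _ dy a∉L = a∉L (∈-coloursExcept (copy G (K ℓ) d x) (adj⇒≢ (K ℓ) ji) dy)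
        -- Across an edge of G, `source` finds the colour in the copy of H at `y`, and the
        -- completion `c′` keeps it there, next to (x , v).
        case y j (inj₂ yx) _ dy _ with source y j a dy
        ... | w , cw = pr _ _ a (lex-adj-across G H w v yx) (ext _ a cw) c′v

  update-both : ∀ {c d} → Projects c d → ∀ x v a → d (verK x (φ v)) ≡ nothing → a < k →
    Avail (lex G (K ℓ)) d (verK x (φ v)) a → c (verH x v) ≡ nothing →
    Projects (update c (verH x v) a) (update d (verK x (φ v)) a)
  update-both {c} {d} R x v a dv a<k av cv = record
    { image   = λ y w b eq → img y w b (update-just⁻ c _ a eq)
    ; source  = λ y j b eq → src y j b (update-just⁻ d _ a eq)
    ; proper  = proper-update (lex G (K ℓ)) d _ a av proper
    ; bounded = bounded-update d _ a a<k bounded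
    }
    where
    open Projects R
    img : ∀ y w b → (verH y w ≡ verH x v × a ≡ b) ⊎ c (verH y w) ≡ just b →
      update d (verK x (φ v)) a (verK y (φ w)) ≡ just b
    img y w b (inj₁ (eq , refl)) with vertex-injective G H y w x v eq
    ... | refl , refl = update-same d _ a
    img y w b (inj₂ cy) = update-just⁺ d a dv (image y w b cy)
    src : ∀ y j b → (verK y j ≡ verK x (φ v) × a ≡ b) ⊎ d (verK y j) ≡ just b →
      ∃[ w ] update c (verH x v) a (verH y w) ≡ just b
    src y j b (inj₁ (eq , refl)) with vertex-injective G (K ℓ) y j x (φ v) eq
    ... | refl , refl = v , update-same c _ a
    src y j b (inj₂ dy) with source y j b dy
    ... | w , cw = w , update-just⁺ c a cv cw

  update-source : ∀ {c d} → Projects c d → ∀ x v a → d (verK x (φ v)) ≡ just a →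
    c (verH x v) ≡ nothing → Projects (update c (verH x v) a) d
  update-source {c} {d} R x v a dv cv = record
    { image   = λ y w b eq → img y w b (update-just⁻ c _ a eq)
    ; source  = λ y j b eq → let w , cw = source y j b eq in w , update-just⁺ c a cv cw
    ; proper  = proper
    ; bounded = bounded
    }
    where
    open Projects R
    img : ∀ y w b → (verH y w ≡ verH x v × a ≡ b) ⊎ c (verH y w) ≡ just b →
      d (verK y (φ w)) ≡ just b
    img y w b (inj₁ (eq , refl)) with vertex-injective G H y w x v eq
    ... | refl , refl = dv
    img y w b (inj₂ cy) = image y w b cy

  -- The recursion is on the winning tree for G[H]; the real game stands still whenever the answer
  -- is already fixed. `not-blocked` needs the whole tree, so it is applied before `project-move`
  -- treats the move.
  project-win : ∀ {c d} → Projects c d → Win (lex G H) k c → Win (lex G (K ℓ)) k d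
  project-move : ∀ {c d} → Projects c d → ∀ x v → c (verH x v) ≡ nothing →
    ∃[ a ] (a < k × Avail (lex G (K ℓ)) d (verK x (φ v)) a) →
    (∀ a → a < k → Avail (lex G H) c (verH x v) a → Win (lex G H) k (update c (verH x v) a)) →
    Win (lex G (K ℓ)) k d

  project-win {c} {d} R (done all) = done (vertex-elim G (K ℓ) _ λ x i → filled x i (φ-surjective i))
    where
    filled : ∀ x i → ∃[ v ] φ v ≡ i → d (verK x i) ≢ nothing
    filled x _ (v , refl) with coloured _ (all (verH x v))
    ... | a , cv = just≢nothing (Projects.image R x v a cv)
  project-win {c} {d} R win@(move u cu free next) with vertex-surjective G H u
  ... | x , v , refl = project-move R x v cu (not-blocked R win x (φ v)) next

  project-move {c} {d} R x v cv free next with d (verK x (φ v)) in dv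
  ... | nothing = move (verK x (φ v)) dv free λ a a<k av →
    project-win (update-both R x v a dv a<k av cv) (next a a<k (image-avail R x v a av))
  -- The imagined Ben repeats the colour `a` of (x , φ v); this is legal because `d` is proper.
  ... | just a = project-win (update-source R x v a dv cv) (next a (bounded _ a dv) (image-avail R x v a av))
    where
    open Projects R
    av : Avail (lex G (K ℓ)) d (verK x (φ v)) a
    av u uv du = proper u _ a uv du dv

  lex⇒lexK : IndColorable (lex G H) k → IndColorable (lex G (K ℓ)) k
  lex⇒lexK = project-win record
    { image = λ _ _ _ () ; source = λ _ _ _ () ; proper = λ _ _ _ _ () ; bounded = λ _ _ () }

-- From G[K_ℓ] to G[H]

colours : ∀ {m} → Hist m → List ℕ
colours = map proj₂

rename : ∀ {m} → (ℕ → ℕ) → Hist m → Hist m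
rename f = map (map₂ f)

-- Not definitional, since `posOf` and `update` compare the two vertices in opposite orders.
posOf-∷ : ∀ {m} u a (h : Hist m) v → posOf ((u , a) ∷ h) v ≡ update (posOf h) u a v
posOf-∷ u a h v with u ≟ v | v ≟ u
... | yes _  | yes _  = refl
... | yes eq | no ¬eq = contradiction (sym eq) ¬eq
... | no ¬eq | yes eq = contradiction (sym eq) ¬eq
... | no _   | no _   = refl

posOf⇒∈ : ∀ {m} (h : Hist m) {v a} → posOf h v ≡ just a → a ∈ colours h
posOf⇒∈ ((u , b) ∷ h) {v} eq with u ≟ v
... | yes _ = here (sym (just-injective eq))
... | no _  = there (posOf⇒∈ h eq)

posOf-rename : ∀ {m} f (h : Hist m) v → posOf (rename f h) v ≡ Maybe.map f (posOf h v)
posOf-rename f []            v = refl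
posOf-rename f ((u , _) ∷ h) v with u ≟ v
... | yes _ = refl
... | no _  = posOf-rename f h v

∈-rename⁺ : ∀ {m} f (h : Hist m) {a} → a ∈ colours h → f a ∈ colours (rename f h)
∈-rename⁺ f (_ ∷ h) (here refl) = here refl
∈-rename⁺ f (_ ∷ h) (there p)   = there (∈-rename⁺ f h p)

∈-rename⁻ : ∀ {m} f (h : Hist m) {b} → b ∈ colours (rename f h) → ∃[ a ] (a ∈ colours h × b ≡ f a)
∈-rename⁻ f (_ ∷ h) (here refl) = _ , here refl , refl
∈-rename⁻ f (_ ∷ h) (there p) with ∈-rename⁻ f h p
... | a , q , eq = a , there q , eq

used : ∀ {m} → Hist m → List ℕ
used h = deduplicate _≟ℕ_ (colours h)

nUsed-rename : ∀ {m f} → Injective _≡_ _≡_ f → (h : Hist m) → nUsed (rename f h) ≡ nUsed h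
nUsed-rename {f = f} inj h = ≤-antisym
  (subst (nUsed (rename f h) ≤_) (length-map f (used h))
    (unique-⊆⇒length≤ (deduplicate-! _) renamed⊆))
  (subst (_≤ nUsed (rename f h)) (length-map f (used h))
    (unique-⊆⇒length≤ (map⁺ inj (deduplicate-! (colours h))) ⊆renamed))
  where
  renamed⊆ : ∀ {b} → b ∈ used (rename f h) → b ∈ map f (used h)
  renamed⊆ p with ∈-rename⁻ f h (∈-deduplicate⁻ _≟ℕ_ _ p)
  ... | a , q , refl = ∈-map⁺ f (∈-deduplicate⁺ _≟ℕ_ q)
  ⊆renamed : ∀ {b} → b ∈ map f (used h) → b ∈ used (rename f h)
  ⊆renamed p with ∈-map⁻ f p
  ... | a , q , refl = ∈-deduplicate⁺ _≟ℕ_ (∈-rename⁺ f h (∈-deduplicate⁻ _≟ℕ_ (colours h) q))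

Renames : ∀ {m} → (ℕ → ℕ) → Pos m → Pos m → Set
Renames f e e′ = ∀ v → e′ v ≡ Maybe.map f (e v)

avail-rename⁺ : ∀ H {f} e e′ v {a} → Injective _≡_ _≡_ f → Renames f e e′ → Avail H e v a → Avail H e′ v (f a)
avail-rename⁺ H e _ v {a} inj ren av u uv e′u =
  av u uv (map-injective inj {x = e u} {y = just a} (trans (sym (ren u)) e′u))

avail-rename⁻ : ∀ H {f} e e′ v {a} → Renames f e e′ → Avail H e′ v (f a) → Avail H e v a
avail-rename⁻ H {f} e _ v ren av u uv eu = av u uv (trans (ren u) (cong (Maybe.map f) eu))

renames-update : ∀ {m f} (e e′ : Pos m) v a → Renames f e e′ → Renames f (update e v a) (update e′ v (f a))
renames-update e e′ v a ren u with u ≟ v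
... | yes _ = refl
... | no _  = ren u

-- Histories of plays against σ that end no later than the first move after which ℓ colours are in use.
data Legal (H : Graph) (σ : Strategy (n H)) (ℓ : ℕ) : Hist (n H) → Set where
  []   : Legal H σ ℓ []
  step : ∀ {h a} → nUsed h < ℓ → posOf h (σ h) ≡ nothing → Avail H (posOf h) (σ h) a →
         Legal H σ ℓ h → Legal H σ ℓ ((σ h , a) ∷ h)

proper-resp : ∀ G {c c′} → (∀ v → c′ v ≡ c v) → Proper G c → Proper G c′
proper-resp G eq pr u v a uv cu cv = pr u v a uv (trans (sym (eq u)) cu) (trans (sym (eq v)) cv)

module _ {H : Graph} {σ : Strategy (n H)} {ℓ : ℕ} where

  legal-proper : ∀ {h} → Legal H σ ℓ h → Proper H (posOf h)
  legal-proper []                        = λ _ _ _ _ ()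
  legal-proper (step {h} {a} _ _ av leg) =
    proper-resp H (posOf-∷ (σ h) a h) (proper-update H (posOf h) (σ h) a av (legal-proper leg))

  -- Legal moves are made at uncoloured vertices, so no colour of the history is ever overwritten.
  ∈⇒posOf : ∀ {h a} → Legal H σ ℓ h → a ∈ colours h → ∃[ v ] posOf h v ≡ just a
  ∈⇒posOf (step {h} {a} _ _ _ _) (here refl) = σ h , trans (posOf-∷ (σ h) a h _) (update-same (posOf h) _ a)
  ∈⇒posOf (step {h} {a} _ free _ leg) (there p) with ∈⇒posOf leg p
  ... | v , eq = v , trans (posOf-∷ (σ h) a h v) (update-just⁺ (posOf h) a free eq)

  -- `Legal` does not mention the number of colours, so a legal history can be replayed, renamed, in
  -- the game with `j` colours. The replay cannot stop early: before each move fewer than ℓ colours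
  -- are in use and `σ h` is uncoloured.
  follow-legal : ColourInvariant σ → ∀ {j f} → Injective _≡_ _≡_ f → FollowThenWin H σ ℓ j [] →
    ∀ {h} → Legal H σ ℓ h → (∀ {a} → a ∈ colours h → f a < j) → FollowThenWin H σ ℓ j (rename f h)
  follow-legal σ-inv inj start [] _ = start
  follow-legal σ-inv {j} {f} inj start (step {h} {a} lt free av leg) f<
    with follow-legal σ-inv inj start leg (f< ∘ there)
  ... | switch ge _     = contradiction (subst (ℓ ≤_) (nUsed-rename inj h) ge) (<⇒≱ lt)
  ... | done all        = contradiction (trans (posOf-rename f h (σ h)) (cong (Maybe.map f) free)) (all (σ h))
  -- The tree continues at `σ (rename f h)`, which colour invariance identifies with `σ h`.
  ... | move _ _ _ next = subst
    (λ v → Avail H (posOf (rename f h)) v (f a) → FollowThenWin H σ ℓ j ((v , f a) ∷ rename f h))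
    (σ-inv f inj h) (next (f a) (f< (here refl))) (avail-rename⁺ H (posOf h) _ (σ h) inj (posOf-rename f h) av)

module _ (G H : Graph) (ℓ k : ℕ) (χ≥ : NeedsColours H ℓ) (ℓ≤k : Fin (n G) → ℓ ≤ k)
         (σ : Strategy (n H)) (σ-inv : ColourInvariant σ)
         (σ-wins : ∀ j → ℓ ≤ j → FollowThenWin H σ ℓ j []) where

  private
    verH = vertex G H
    verK = vertex G (K ℓ)

  Tracks : Pos (n (lex G H)) → Fin (n G) → Hist (n H) → Set
  Tracks c x h = ∀ v → c (verH x v) ≡ posOf h v

  -- All vertices of one copy have the same neighbours outside it, so this half of availability
  -- depends on the copy alone.
  Avoids : Pos (n (lex G H)) → Fin (n G) → ℕ → Set
  Avoids c x a = ∀ y w → adj G y x ≡ true → c (verH y w) ≢ just a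

  avoids? : ∀ c x a → Dec (Avoids c x a)
  avoids? c x a with any? (λ y → any? (λ w → (adj G y x ≟ᵇ true) ×-dec (Maybe-≡-dec _≟ℕ_ (c (verH y w)) (just a))))
  ... | yes (y , w , yx , cy) = no (λ av → av y w yx cy)
  ... | no ¬bad               = yes (λ y w yx cy → ¬bad (y , w , yx , cy))

  avail-split : ∀ c x v {a} → (∀ w → adj H w v ≡ true → c (verH x w) ≢ just a) → Avoids c x a →
    Avail (lex G H) c (verH x v) a
  avail-split c x v {a} inside across = vertex-elim G H _ λ y w yw cy → case y w (lex-adj⁻ G H y w x v yw) cy
    where
    case : ∀ y w → (y ≡ x × adj H w v ≡ true) ⊎ adj G y x ≡ true → c (verH y w) ≢ just a
    case y w (inj₁ (refl , wv)) = inside w wv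
    case y w (inj₂ yx)          = across y w yx

  avail-inside : ∀ c x v {a} → Avail (lex G H) c (verH x v) a → Avail H (copy G H c x) v a
  avail-inside c x v av w wv = av (verH x w) (lex-adj-inside G H x wv)

  avail-across : ∀ c x v {a} → Avail (lex G H) c (verH x v) a → Avoids c x a
  avail-across c x v av y w yx = av (verH y w) (lex-adj-across G H w v yx)

  SeparatesCopies : Pos (n (lex G H)) → Set
  SeparatesCopies c = ∀ x v a → c (verH x v) ≡ just a → Avoids c x a

  Filled : Pos (n (lex G H)) → Fin (n G) → Set
  Filled c x = AllColored (copy G H c x)

  -- The first phase of `σ` has ended in the copy at `x`.
  Ready : Pos (n (lex G H)) → Fin (n G) → Set
  Ready c x = ∃[ h ] (Legal H σ ℓ h × ℓ ≤ nUsed h × Tracks c x h)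

  AgreesOff : Fin (n G) → Pos (n (lex G H)) → Pos (n (lex G H)) → Set
  AgreesOff x c₀ c = ∀ y v → y ≢ x → c (verH y v) ≡ c₀ (verH y v)

  update-off : ∀ c x v a → AgreesOff x c (update c (verH x v) a)
  update-off c x v a y w y≢x = update-other c a (λ eq → y≢x (proj₁ (vertex-injective G H y w x v eq)))

  update-on : ∀ c x v a w → update c (verH x v) a (verH x w) ≡ update (copy G H c x) v a w
  update-on c x v a w with verH x w ≟ verH x v | w ≟ v
  ... | yes _ | yes _    = refl
  ... | yes eq | no w≢v  = contradiction (proj₂ (vertex-injective G H x w x v eq)) w≢v
  ... | no ¬eq | yes refl = contradiction refl ¬eq
  ... | no _ | no _      = refl

  -- Completing the copies of H one at a time.

  module _ (c₀ : Pos (n (lex G H))) (sep : SeparatesCopies c₀) (bd : Bounded k c₀) (x : Fin (n G)) where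

    -- Computed from `c₀` once and for all: the neighbouring copies do not change while the copy at
    -- `x` is completed.
    allowed : List ℕ
    allowed = filter (avoids? c₀ x) (upTo k)

    allowed-unique : Unique allowed
    allowed-unique = filter⁺ (avoids? c₀ x) (upTo⁺ k)

    ∈-allowed : ∀ {a} → a < k → Avoids c₀ x a → a ∈ allowed
    ∈-allowed a<k av = ∈-filter⁺ (avoids? c₀ x) (∈-upTo⁺ a<k) av

    allowed< : ∀ {a} → a ∈ allowed → a < k
    allowed< p = ∈-upTo⁻ (proj₁ (∈-filter⁻ (avoids? c₀ x) p))

    allowed-avoids : ∀ {a} → a ∈ allowed → Avoids c₀ x a
    allowed-avoids p = proj₂ (∈-filter⁻ (avoids? c₀ x) {xs = upTo k} p)

    adj⇒off : ∀ {y} → adj G y x ≡ true → y ≢ x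
    adj⇒off yx = adj⇒≢ G yx

    -- The rest of the game, to be grafted onto every leaf of the play inside the copy at `x`.
    Continue : Set
    Continue = ∀ c → AgreesOff x c₀ c → Filled c x → SeparatesCopies c → Bounded k c → Win (lex G H) k c

    separates : ∀ c → AgreesOff x c₀ c → (∀ v a → c (verH x v) ≡ just a → a ∈ allowed) → SeparatesCopies c
    separates c off within y v a cy z w zy cz with y ≟ x | z ≟ x
    ... | yes refl | yes refl = adj⇒off zy refl
    ... | yes refl | no z≢x   = allowed-avoids (within v a cy) z w zy (trans (sym (off z w z≢x)) cz)
    ... | no y≢x   | yes refl = allowed-avoids (within w a cz) y v (trans (adj-sym G y x) zy)
      (trans (sym (off y v y≢x)) cy)
    ... | no y≢x   | no z≢x   = sep y v a (trans (sym (off y v y≢x)) cy) z w zy (trans (sym (off z w z≢x)) cz)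

    stays-bounded : ∀ c → AgreesOff x c₀ c → (∀ v a → c (verH x v) ≡ just a → a ∈ allowed) → Bounded k c
    stays-bounded c off within = vertex-elim G H _ λ y v a cy → case y v a cy (y ≟ x)
      where
      case : ∀ y v a → c (verH y v) ≡ just a → Dec (y ≡ x) → a < k
      case y v a cy (yes refl) = allowed< (within v a cy)
      case y v a cy (no y≢x)   = bd _ a (trans (sym (off y v y≢x)) cy)

    -- The tree on H is followed through `rank allowed`: Ben's colours are sent forward along it,
    -- and the tree's witness that a vertex is not blocked is pulled back by surjectivity.
    play-copy : ∀ {e} → Win H (length allowed) e → Continue → ∀ c → Renames (rank allowed) (copy G H c x) e →
      (∀ v a → c (verH x v) ≡ just a → a ∈ allowed) → AgreesOff x c₀ c → Win (lex G H) k c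
    play-copy (done all) cont c ren within off =
      cont c off (λ v cv → all v (trans (ren v) (cong (Maybe.map _) cv)))
        (separates c off within) (stays-bounded c off within)
    play-copy {e} (move v ev (b , b< , avb) next) cont c ren within off =
      move (verH x v) free (unblocked (rank-surjective allowed-unique b<)) continue
      where
      free : c (verH x v) ≡ nothing
      free = map-nothing⁻ (trans (sym (ren v)) ev)
        where
        map-nothing⁻ : ∀ {m : Maybe ℕ} → Maybe.map (rank allowed) m ≡ nothing → m ≡ nothing
        map-nothing⁻ {nothing} _ = refl

      avoids : ∀ {a} → Avoids c₀ x a → Avoids c x a
      avoids av y w yx cy = av y w yx (trans (sym (off y w (adj⇒off yx))) cy)

      unblocked : ∃[ a ] (a ∈ allowed × rank allowed a ≡ b) → ∃[ a ] (a < k × Avail (lex G H) c (verH x v) a)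
      unblocked (a , a∈ , refl) = a , allowed< a∈ ,
        avail-split c x v (avail-rename⁻ H (copy G H c x) e v ren avb) (avoids (allowed-avoids a∈))

      continue : ∀ a → a < k → Avail (lex G H) c (verH x v) a → Win (lex G H) k (update c (verH x v) a)
      continue a a<k av = play-copy
        (next (rank allowed a) (rank< a∈)
          (avail-rename⁺ H (copy G H c x) e v (rank-injective allowed) ren (avail-inside c x v av)))
        cont _
        (λ w → trans (renames-update (copy G H c x) e v a ren w)
          (cong (Maybe.map (rank allowed)) (sym (update-on c x v a w))))
        (λ w b eq → within′ w b (update-just⁻ c _ a eq))
        (λ y w y≢x → trans (update-off c x v a y w y≢x) (off y w y≢x))
        where
        a∈ : a ∈ allowed
        -- Ben's colour avoids the neighbouring copies in `c`, where `c` agrees with `c₀`.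
        a∈ = ∈-allowed a<k λ y w yx cy → avail-across c x v av y w yx (trans (off y w (adj⇒off yx)) cy)
        within′ : ∀ w b → (verH x w ≡ verH x v × a ≡ b) ⊎ c (verH x w) ≡ just b → b ∈ allowed
        within′ w b (inj₁ (_ , refl)) = a∈
        within′ w b (inj₂ cw)         = within w b cw

    -- The colours already on the copy are absent from its neighbours, hence allowed. So at least ℓ
    -- colours are allowed, and `σ` has a second phase for exactly that number.
    finish-copy : Ready c₀ x → Continue → Win (lex G H) k c₀
    finish-copy (h , leg , ℓ≤ , tr) cont =
      play-copy
        (win (follow-legal σ-inv (rank-injective allowed) (σ-wins (length allowed) ℓ≤allowed) leg (rank< ∘ colours⊆allowed)))
        cont c₀ (λ v → trans (posOf-rename (rank allowed) h v) (cong (Maybe.map (rank allowed)) (sym (tr v))))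
        within (λ _ _ _ → refl)
      where
      within : ∀ v a → c₀ (verH x v) ≡ just a → a ∈ allowed
      within v a cv = ∈-allowed (bd _ a cv) (sep x v a cv)

      colours⊆allowed : ∀ {a} → a ∈ colours h → a ∈ allowed
      colours⊆allowed p with ∈⇒posOf leg p
      ... | v , eq = within v _ (trans (tr v) eq)

      ℓ≤allowed : ℓ ≤ length allowed
      ℓ≤allowed = ≤-trans ℓ≤ (unique-⊆⇒length≤ (deduplicate-! (colours h))
        (λ p → colours⊆allowed (∈-deduplicate⁻ _≟ℕ_ (colours h) p)))

      win : FollowThenWin H σ ℓ (length allowed) (rename (rank allowed) h) →
        Win H (length allowed) (posOf (rename (rank allowed) h))
      win (switch _ w)    = w
      win (done all)      = done all
      win (move lt _ _ _) = contradiction ℓ≤ (<⇒≱ (subst (_< ℓ) (nUsed-rename (rank-injective allowed) h) lt))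

  -- `xs` lists the copies still to be treated. Readiness refers to one copy only, so it survives
  -- the completion of another.
  finish : ∀ xs c → SeparatesCopies c → Bounded k c → (∀ x → Filled c x ⊎ (x ∈ xs × Ready c x)) → Win (lex G H) k c
  finish [] c sep bd status = done (vertex-elim G H _ λ x v → filled x (status x) v)
    where
    filled : ∀ x → Filled c x ⊎ (x ∈ [] × Ready c x) → Filled c x
    filled x (inj₁ p) = p
  finish (x ∷ xs) c sep bd status with status x
  ... | inj₁ fx = finish xs c sep bd (λ y → drop y (status y))
    where
    drop : ∀ y → Filled c y ⊎ (y ∈ x ∷ xs × Ready c y) → Filled c y ⊎ (y ∈ xs × Ready c y)
    drop y (inj₁ fy)              = inj₁ fy
    drop y (inj₂ (here refl , _)) = inj₁ fx
    drop y (inj₂ (there p , r))   = inj₂ (p , r)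
  ... | inj₂ (_ , ready) = finish-copy c sep bd x ready λ c′ off fx sep′ bd′ →
    finish xs c′ sep′ bd′ (λ y → drop c′ off fx y (y ≟ x) (status y))
    where
    drop : ∀ c′ → AgreesOff x c c′ → Filled c′ x → ∀ y → Dec (y ≡ x) →
      Filled c y ⊎ (y ∈ x ∷ xs × Ready c y) → Filled c′ y ⊎ (y ∈ xs × Ready c′ y)
    drop c′ off fx y (yes refl) _                      = inj₁ fx
    drop c′ off fx y (no y≢x)   (inj₁ fy)              = inj₁ (λ v eq → fy v (trans (sym (off y v y≢x)) eq))
    drop c′ off fx y (no y≢x)   (inj₂ (here y≡x , _))  = contradiction y≡x y≢x
    drop c′ off fx y (no y≢x)   (inj₂ (there p , h , leg , ℓ≤ , tr)) =
      inj₂ (p , h , leg , ℓ≤ , λ v → trans (off y v y≢x) (tr v))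

  -- First phase: simulating the game on G[K_ℓ].

  -- `fwd` and `bwd` say that the two copies at `x` carry the same set of colours; no vertex of H is
  -- matched with a vertex of K_ℓ.
  record Simulates (c : Pos (n (lex G H))) (d : Pos (n (lex G (K ℓ)))) : Set where
    field
      track   : ∀ x → ∃[ h ] (Legal H σ ℓ h × Tracks c x h)
      fwd     : ∀ x v a → c (verH x v) ≡ just a → ∃[ i ] d (verK x i) ≡ just a
      bwd     : ∀ x i a → d (verK x i) ≡ just a → ∃[ v ] c (verH x v) ≡ just a
      proper  : Proper (lex G (K ℓ)) d
      bounded : Bounded k d

  track-update : ∀ c → (∀ y → ∃[ h ] (Legal H σ ℓ h × Tracks c y h)) →
    ∀ x {h a} → Legal H σ ℓ h → Tracks c x h → Legal H σ ℓ ((σ h , a) ∷ h) →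
    Tracks (update c (verH x (σ h)) a) x ((σ h , a) ∷ h)
    × (∀ y → ∃[ h′ ] (Legal H σ ℓ h′ × Tracks (update c (verH x (σ h)) a) y h′))
  track-update c track x {h} {a} leg tr leg′ = here′ , λ y → all y (y ≟ x)
    where
    here′ : Tracks (update c (verH x (σ h)) a) x ((σ h , a) ∷ h)
    here′ v = trans (update-on c x (σ h) a v) (trans (cong-update v) (sym (posOf-∷ (σ h) a h v)))
      where
      cong-update : ∀ v → update (copy G H c x) (σ h) a v ≡ update (posOf h) (σ h) a v
      cong-update v with v ≟ σ h
      ... | yes _ = refl
      ... | no _  = tr v
    all : ∀ y → Dec (y ≡ x) → ∃[ h′ ] (Legal H σ ℓ h′ × Tracks (update c (verH x (σ h)) a) y h′)
    all y (yes refl) = (σ h , a) ∷ h , leg′ , here′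
    all y (no y≢x) with track y
    ... | h′ , leg″ , tr′ = h′ , leg″ , λ v → trans (update-off c x (σ h) a y v y≢x) (tr′ v)

  module _ {c d} (S : Simulates c d) where
    open Simulates S

    separates-copies : SeparatesCopies c
    separates-copies x v a cx y w yx cy with fwd x v a cx | fwd y w a cy
    ... | i , dx | j , dy = proper _ _ a (lex-adj-across G (K ℓ) j i yx) dy dx

    bounded-sim : Bounded k c
    bounded-sim = vertex-elim G H _ λ x v a cx → bounded _ a (proj₂ (fwd x v a cx))

    -- A full copy of K_ℓ carries ℓ colours, and by `bwd` all of them occur in the history of the
    -- copy of H.
    all-ready : AllColored d → ∀ x → Ready c x
    all-ready all x with track x
    ... | h , leg , tr = h , leg ,
      colours-needed (K ℓ) (needs-K ℓ) (copy G (K ℓ) d x) (λ i → all (verK x i)) (proper-copy G (K ℓ) d proper x)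
        (used h) inUsed , tr
      where
      inUsed : ∀ i a → d (verK x i) ≡ just a → a ∈ used h
      inUsed i a di with bwd x i a di
      ... | v , cv = ∈-deduplicate⁺ _≟ℕ_ (posOf⇒∈ h (trans (sym (tr v)) cv))

    module _ {x h} (leg : Legal H σ ℓ h) (tr : Tracks c x h) {i} (di : d (verK x i) ≡ nothing) where

      free-index : ∀ {j a} → d (verK x j) ≡ just a → j ≢ i
      free-index dj refl = just≢nothing dj di

      used⇒d : ∀ {a} → a ∈ colours h → ∃[ j ] d (verK x j) ≡ just a
      used⇒d p with ∈⇒posOf leg p
      ... | v , eq = fwd x v _ (trans (tr v) eq)

      -- All colours of the copy of H sit on vertices (x , j) with `j ≢ i`, as (x , i) is
      -- uncoloured.
      nUsed<ℓ : nUsed h < ℓ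
      nUsed<ℓ = ≤-<-trans (unique-⊆⇒length≤ (deduplicate-! (colours h)) sub)
        (length-coloursExcept (copy G (K ℓ) d x) i)
        where
        sub : ∀ {a} → a ∈ used h → a ∈ coloursExcept (copy G (K ℓ) d x) i
        sub p with used⇒d (∈-deduplicate⁻ _≟ℕ_ (colours h) p)
        ... | j , dj = ∈-coloursExcept (copy G (K ℓ) d x) (free-index dj) dj

      -- The uncoloured (x , i) is adjacent to every coloured vertex of its own copy and to all
      -- neighbouring copies. A colour available there therefore occurs nowhere near the copy of H,
      -- whatever `v` is.
      avail-lift : ∀ {a} v → Avail (lex G (K ℓ)) d (verK x i) a → Avail (lex G H) c (verH x v) a
      avail-lift {a} v av = avail-split c x v inside across
        where
        inside : ∀ w → adj H w v ≡ true → c (verH x w) ≢ just a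
        inside w _ cw with fwd x w a cw
        ... | j , dj = av (verK x j) (lex-adj-inside G (K ℓ) x (K-adj⁺ (free-index dj))) dj
        across : Avoids c x a
        across y w yx cy with fwd y w a cy
        ... | j , dj = av (verK y j) (lex-adj-across G (K ℓ) j i yx) dj

      -- For a colour new to the copy, only the neighbouring copies can cause a conflict.
      avail-lower : ∀ {a v} → a ∉ colours h → Avail (lex G H) c (verH x v) a → Avail (lex G (K ℓ)) d (verK x i) a
      avail-lower {a} {v} a∉ av = vertex-elim G (K ℓ) _ λ y j yj dy → case y j (lex-adj⁻ G (K ℓ) y j x i yj) dy
        where
        case : ∀ y j → (y ≡ x × adj (K ℓ) j i ≡ true) ⊎ adj G y x ≡ true → d (verK y j) ≢ just a
        case y j (inj₁ (refl , _)) dy with bwd y j a dy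
        ... | w , cw = a∉ (posOf⇒∈ h (trans (sym (tr w)) cw))
        case y j (inj₂ yx) dy with bwd y j a dy
        ... | w , cw = avail-across c x v av y w yx cw

  repeat-colour : ∀ {c d} → Simulates c d → ∀ x v a → c (verH x v) ≡ nothing → ∃[ j ] d (verK x j) ≡ just a →
    (∀ y → ∃[ h ] (Legal H σ ℓ h × Tracks (update c (verH x v) a) y h)) → Simulates (update c (verH x v) a) d
  repeat-colour {c} {d} S x v a cv old track′ = record
    { track   = track′
    ; fwd     = λ y w b eq → fwd′ y w b (update-just⁻ c _ a eq)
    ; bwd     = λ y j b dy → let w , cw = bwd y j b dy in w , update-just⁺ c a cv cw
    ; proper  = proper
    ; bounded = bounded
    }
    where
    open Simulates S
    fwd′ : ∀ y w b → (verH y w ≡ verH x v × a ≡ b) ⊎ c (verH y w) ≡ just b → ∃[ j ] d (verK y j) ≡ just b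
    fwd′ y w b (inj₁ (eq , refl)) with vertex-injective G H y w x v eq
    ... | refl , _ = old
    fwd′ y w b (inj₂ cy) = fwd y w b cy

  new-colour : ∀ {c d} → Simulates c d → ∀ x v i a → c (verH x v) ≡ nothing → d (verK x i) ≡ nothing → a < k →
    Avail (lex G (K ℓ)) d (verK x i) a →
    (∀ y → ∃[ h ] (Legal H σ ℓ h × Tracks (update c (verH x v) a) y h)) →
    Simulates (update c (verH x v) a) (update d (verK x i) a)
  new-colour {c} {d} S x v i a cv di a<k av track′ = record
    { track   = track′
    ; fwd     = λ y w b eq → fwd′ y w b (update-just⁻ c _ a eq)
    ; bwd     = λ y j b eq → bwd′ y j b (update-just⁻ d _ a eq)
    ; proper  = proper-update (lex G (K ℓ)) d _ a av proper
    ; bounded = bounded-update d _ a a<k bounded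
    }
    where
    open Simulates S
    fwd′ : ∀ y w b → (verH y w ≡ verH x v × a ≡ b) ⊎ c (verH y w) ≡ just b →
      ∃[ j ] update d (verK x i) a (verK y j) ≡ just b
    fwd′ y w b (inj₁ (eq , refl)) with vertex-injective G H y w x v eq
    ... | refl , _ = i , update-same d _ a
    fwd′ y w b (inj₂ cy) with fwd y w b cy
    ... | j , dj = j , update-just⁺ d a di dj
    bwd′ : ∀ y j b → (verK y j ≡ verK x i × a ≡ b) ⊎ d (verK y j) ≡ just b →
      ∃[ w ] update c (verH x v) a (verH y w) ≡ just b
    bwd′ y j b (inj₁ (eq , refl)) with vertex-injective G (K ℓ) y j x i eq
    ... | refl , _ = v , update-same c _ a
    bwd′ y j b (inj₂ dy) with bwd y j b dy
    ... | w , cw = w , update-just⁺ c a cv cw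

  module _ {d x i} (di : d (verK x i) ≡ nothing)
           (unblocked : ∃[ a ] (a < k × Avail (lex G (K ℓ)) d (verK x i) a))
           (next : ∀ c a → a < k → Avail (lex G (K ℓ)) d (verK x i) a →
                   Simulates c (update d (verK x i) a) → Win (lex G H) k c) where

    -- The recursion is on the tree of `σ`, so Ben can repeat old colours only finitely often;
    -- `next` takes over at the first new one.
    present-copy : ∀ {h} → FollowThenWin H σ ℓ k h → ∀ c → Simulates c d → Legal H σ ℓ h → Tracks c x h →
      Win (lex G H) k c
    present-copy (switch ge _) c S leg tr = contradiction ge (<⇒≱ (nUsed<ℓ S leg tr di))
    -- A full copy of H would carry at least ℓ colours.
    present-copy {h} (done all) c S leg tr = contradiction
      (colours-needed H χ≥ (posOf h) all (legal-proper leg) (used h)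
        (λ v a eq → ∈-deduplicate⁺ _≟ℕ_ (posOf⇒∈ h eq)))
      (<⇒≱ (nUsed<ℓ S leg tr di))
    present-copy {h} (move lt free _ follow) c S leg tr =
      move (verH x (σ h)) cfree
        (map₂ (map₂ (avail-lift S leg tr di (σ h))) unblocked)
        λ a a<k av → answer a a<k av (a ∈? colours h)
      where
      cfree : c (verH x (σ h)) ≡ nothing
      cfree = trans (tr (σ h)) free
      answer : ∀ a → a < k → Avail (lex G H) c (verH x (σ h)) a → Dec (a ∈ colours h) →
        Win (lex G H) k (update c (verH x (σ h)) a)
      answer a a<k av = case
        where
        av′ : Avail H (posOf h) (σ h) a
        av′ u uv eq = avail-inside c x (σ h) av u uv (trans (tr u) eq)
        leg′ : Legal H σ ℓ ((σ h , a) ∷ h)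
        leg′ = step lt free av′ leg
        tracks = track-update c (Simulates.track S) x leg tr leg′
        case : Dec (a ∈ colours h) → Win (lex G H) k (update c (verH x (σ h)) a)
        -- An old colour leaves `d` unchanged, and (x , i) is still to be answered.
        case (yes p) = present-copy (follow a a<k av′) _
          (repeat-colour S x (σ h) a cfree (used⇒d S leg tr di p) (proj₂ tracks)) leg′ (proj₁ tracks)
        case (no ¬p) = next _ a a<k av″ (new-colour S x (σ h) i a cfree di a<k av″ (proj₂ tracks))
          where
          av″ = avail-lower S leg tr di ¬p av

  simulate : ∀ {c d} → Win (lex G (K ℓ)) k d → Simulates c d → Win (lex G H) k c
  simulate {c} (done all) S = finish (allFin (n G)) c (separates-copies S) (bounded-sim S)
    (λ x → inj₂ (∈-allFin x , all-ready S all x))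
  simulate {c} (move u du unblocked next) S with vertex-surjective G (K ℓ) u
  ... | x , i , refl with Simulates.track S x
  ...   | h , leg , tr = present-copy du unblocked (λ c′ a a<k av → simulate (next a a<k av))
    -- Renaming by the identity resumes the first phase, with `k` colours, at the stored history.
    (subst (FollowThenWin H σ ℓ k) (map-id h)
      (follow-legal σ-inv {f = id} id (σ-wins k (ℓ≤k x)) leg colours<k))
    c S leg tr
    where
    colours<k : ∀ {a} → a ∈ colours h → a < k
    colours<k p with ∈⇒posOf leg p
    ... | v , eq = bounded-sim S _ _ (trans (tr v) eq)

  lexK⇒lex : IndColorable (lex G (K ℓ)) k → IndColorable (lex G H) k
  lexK⇒lex win = simulate win record
    { track = λ _ → [] , [] , λ _ → refl ; fwd = λ _ _ _ () ; bwd = λ _ _ _ ()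
    ; proper = λ _ _ _ _ () ; bounded = λ _ _ () }

-- The equivalence and the indicated chromatic numbers.

-- One copy of K_ℓ already needs ℓ colours. The vertex of G provides that copy; for empty G every
-- `k` is winning.
lexK-needs : ∀ G ℓ k → IndColorable (lex G (K ℓ)) k → Fin (n G) → ℓ ≤ k
lexK-needs G ℓ k win x with win⇒colouring (lex G (K ℓ)) k _ win (λ _ _ _ _ ()) (λ _ _ ())
... | e , all , pr , bd , _ = subst (ℓ ≤_) (length-upTo k)
  (colours-needed (K ℓ) (needs-K ℓ) (copy G (K ℓ) e x) (λ i → all (vertex G (K ℓ) x i))
    (proper-copy G (K ℓ) e pr x) (upTo k) (λ i a ei → ∈-upTo⁺ (bd _ a ei)))

indChromatic-unique : ∀ {G ℓ m} → IsIndChromaticNumber G ℓ → IsIndChromaticNumber G m → ℓ ≡ m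
indChromatic-unique {ℓ = ℓ} {m} (wℓ , ℓ-min) (wm , m-min) with <-cmp ℓ m
... | tri< ℓ<m _ _ = contradiction wℓ (m-min ℓ ℓ<m)
... | tri≈ _ eq _  = eq
... | tri> _ _ m<ℓ = contradiction wm (ℓ-min m m<ℓ)

indChromatic-cong : ∀ {G G′} → (∀ k → IndColorable G k → IndColorable G′ k) →
  (∀ k → IndColorable G′ k → IndColorable G k) →
  ∀ m → IsIndChromaticNumber G m → IsIndChromaticNumber G′ m
indChromatic-cong to from m (win , min) = to m win , λ j j<m w → min j j<m (from j w)

theorem2p3 : (G H : Graph) (ℓ : ℕ)
    → InFamilyH H
    → IsChromaticNumber H ℓ
    → IsIndChromaticNumber H ℓ
    → (∀ k → IndColorable (lex G H) k ⇔ IndColorable (lex G (K ℓ)) k)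
      × (∀ m → IsIndChromaticNumber (lex G H) m ⇔ IsIndChromaticNumber (lex G (K ℓ)) m)
theorem2p3 G H ℓ (ℓ′ , χᵢ′ , σ , σ-inv , _ , σ-wins) ((φ , φ-proper) , χ≥) χᵢ
  -- Membership in the family brings its own number `ℓ′`, which must be ℓ.
  with indChromatic-unique {H} χᵢ χᵢ′
... | refl = (λ k → mk⇔ (to k) (from k))
           , (λ m → mk⇔ (indChromatic-cong to from m) (indChromatic-cong from to m))
  where
  to : ∀ k → IndColorable (lex G H) k → IndColorable (lex G (K ℓ)) k
  to k = lex⇒lexK G H ℓ k χ≥ φ φ-proper
  from : ∀ k → IndColorable (lex G (K ℓ)) k → IndColorable (lex G H) k
  from k win = lexK⇒lex G H ℓ k χ≥ (lexK-needs G ℓ k win) σ σ-inv σ-wins win
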